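{- Let $\Sigma$ be a first-order language and $\mathcal{T}_\Sigma$ the family of all complete theories in $\Sigma$. If $\Sigma$ consists of finitely many $0$-ary and unary predicate symbols and finitely many constant symbols (and nothing else), then ${\rm RS}(\mathcal{T}_\Sigma)$ is finite (a natural number); otherwise ${\rm RS}(\mathcal{T}_\Sigma)=\infty$.
   Context: Theories are complete consistent first-order theories; structures have nonempty universes. If $\Sigma$ is relational, $\mathcal{T}_\Sigma$ is the family of all complete theories of $\Sigma$-structures. If $\Sigma$ contains function symbols (constants being $0$-ary function symbols), each $n$-ary function symbol $f$ is replaced by an $(n+1)$-ary predicate symbol $R_f$ interpreted as the graph $\{(\bar a,b)\mid f(\bar a)=b\}$, and $\mathcal{T}_\Sigma$ is the family of all complete theories of $\Sigma$-structures viewed in this relational language. For a family $\mathcal{T}$ of theories and a sentence $\varphi$ of its language, $\mathcal{T}_\varphi=\{T\in\mathcal{T}\mid\varphi\in T\}$. The rank ${\rm RS}$ of a family is defined as follows: ${\rm RS}(\emptyset)=-1$; ${\rm RS}(\mathcal{T})=0$ for finite nonempty $\mathcal{T}$; ${\rm RS}(\mathcal{T})\ge 1$ for infinite $\mathcal{T}$; for $\alpha=\beta+1$, ${\rm RS}(\mathcal{T})\ge\alpha$ iff there are pairwise inconsistent sentences $\varphi_n$, $n\in\omega$, of the language of $\mathcal{T}$ with ${\rm RS}(\mathcal{T}_{\varphi_n})\ge\beta$ for all $n$; for limit $\alpha$, ${\rm RS}(\mathcal{T})\ge\alpha$ iff ${\rm RS}(\mathcal{T})\ge\beta$ for all $\beta<\alpha$;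 ${\rm RS}(\mathcal{T})=\alpha$ iff ${\rm RS}(\mathcal{T})\ge\alpha$ and not ${\rm RS}(\mathcal{T})\ge\alpha+1$; ${\rm RS}(\mathcal{T})=\infty$ if ${\rm RS}(\mathcal{T})\ge\alpha$ for every ordinal $\alpha$. -}

module Defs where

open import Level using (Level; 0ℓ; suc; _⊔_)
open import Data.Empty.Polymorphic using (⊥)
open import Data.Fin.Base using (Fin; zero)
open import Data.List.Base using (List)
open import Data.List.Relation.Unary.Any using (Any)
open import Data.Nat.Base as ℕ using (ℕ)
import Data.Nat.Induction as ℕ
import Data.Nat.Properties as ℕ
open import Data.Product.Base using (∃; _×_)
open import Data.Sum.Base using (_⊎_; inj₁; inj₂)
open import Data.Vec.Base using (Vec; []; _∷_; lookup; map; init; last)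
open import Function.Bundles using (_↔_)
open import Induction.WellFounded using (WellFounded)
open import Relation.Binary.Bundles using (StrictTotalOrder)
open import Relation.Binary.PropositionalEquality using (_≡_; _≢_)
open import Relation.Nullary.Negation using (¬_)
open import Relation.Unary using (Pred; _∈_; _∩_; _≐_; Satisfiable)

private variable
  ℓ o : Level

------------------------------------------------------------------------
-- First-order logic with equality over relational languages

record Language (ℓ : Level) : Set (suc ℓ) where
  field
    Symbol : Set ℓ
    arity  : Symbol → ℕ

open Language public

infixr 5 _⇒_
infix  6 _≈_

-- Formulas with free variables in Fin n; in `all φ` the bound variable is
-- zero.  The connectives ∧, ∨, ¬ and ∃ are the classical abbreviations.
data Formula (L : Language ℓ) : ℕ → Set ℓ where
  ⊥′  : ∀ {n} → Formula L n
  _≈_ : ∀ {n} → Fin n → Fin n → Formula L n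
  rel : ∀ {n} (R : Symbol L) → Vec (Fin n) (arity L R) → Formula L n
  _⇒_ : ∀ {n} → Formula L n → Formula L n → Formula L n
  all : ∀ {n} → Formula L (ℕ.suc n) → Formula L n

Sentence : Language ℓ → Set ℓ
Sentence L = Formula L 0

record RelStructure (L : Language ℓ) : Set (suc ℓ) where
  field
    Carrier : Set ℓ
    point   : Carrier
    interp  : (R : Symbol L) → Pred (Vec Carrier (arity L R)) ℓ

Sat : {L : Language ℓ} (M : RelStructure L) {n : ℕ} →
      Formula L n → Vec (RelStructure.Carrier M) n → Set ℓ
Sat M ⊥′         ρ = ⊥
Sat M (x ≈ y)    ρ = lookup ρ x ≡ lookup ρ y
Sat M (rel R xs) ρ = map (lookup ρ) xs ∈ RelStructure.interp M R
Sat M (φ ⇒ ψ)    ρ = Sat M φ ρ → Sat M ψ ρ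
Sat M (all φ)    ρ = ∀ a → Sat M φ (a ∷ ρ)

infix 4 _⊨_

_⊨_ : {L : Language ℓ} → RelStructure L → Sentence L → Set ℓ
M ⊨ φ = Sat M φ []

Inconsistent : {L : Language ℓ} → Sentence L → Sentence L → Set (suc ℓ)
Inconsistent {L = L} φ ψ = (M : RelStructure L) → ¬ (M ⊨ φ × M ⊨ ψ)

------------------------------------------------------------------------
-- Theories and families of theories

-- Two theories are identified when they are related by _≐_, i.e. when they
-- contain the same sentences.
Theory : Language ℓ → Set (suc ℓ)
Theory {ℓ} L = Pred (Sentence L) ℓ

Family : Language ℓ → Set (suc (suc ℓ))
Family {ℓ} L = Pred (Theory L) (suc ℓ)

Th : {L : Language ℓ} → RelStructure L → Theory L
Th M φ = M ⊨ φ

infixl 8 _↾_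

_↾_ : {L : Language ℓ} → Family L → Sentence L → Family L
𝒯 ↾ φ = 𝒯 ∩ (φ ∈_)

FiniteFamily : {L : Language ℓ} → Family L → Set (suc ℓ)
FiniteFamily {L = L} 𝒯 =
  ∃ λ (Ts : List (Theory L)) → ∀ T → T ∈ 𝒯 → Any (T ≐_) Ts

------------------------------------------------------------------------
-- Ordinals, represented as positions in well-orders

record WellOrder (o : Level) : Set (suc o) where
  field
    strictTotalOrder : StrictTotalOrder o o o
  open StrictTotalOrder strictTotalOrder public using (Carrier; _<_)
  field
    wellFounded : WellFounded _<_

  IsZero : Carrier → Set o
  IsZero α = ∀ β → ¬ (β < α)

  -- α = β + 1
  IsSucc : Carrier → Carrier → Set o
  IsSucc α β = β < α × (∀ γ → γ < α → ¬ (β < γ))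

  IsLimit : Carrier → Set o
  IsLimit α = ¬ IsZero α × (∀ β → ¬ IsSucc α β)

ω : WellOrder 0ℓ
ω = record
  { strictTotalOrder = ℕ.<-strictTotalOrder
  ; wellFounded      = ℕ.<-wellFounded
  }

------------------------------------------------------------------------
-- The rank RS

module _ {L : Language ℓ} (W : WellOrder o) where

  open WellOrder W

  -- Since every position of W is zero, a successor or a limit, the clauses
  -- below determine RS(𝒯) ≥ α.  For α = 1 the clauses ≥one and ≥succ
  -- overlap and agree.
  data RS≥ (𝒯 : Family L) (α : Carrier) : Set (suc ℓ ⊔ o) where
    ≥zero  : IsZero α → Satisfiable 𝒯 → RS≥ 𝒯 α
    ≥one   : ∀ {β} → IsSucc α β → IsZero β → ¬ FiniteFamily 𝒯 → RS≥ 𝒯 α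
    ≥succ  : ∀ {β} → IsSucc α β → (φ : ℕ → Sentence L) →
             (∀ m n → m ≢ n → Inconsistent (φ m) (φ n)) →
             (∀ n → RS≥ (𝒯 ↾ φ n) β) → RS≥ 𝒯 α
    ≥limit : IsLimit α → (∀ β → β < α → RS≥ 𝒯 β) → RS≥ 𝒯 α

RS_≡_ : {L : Language ℓ} → Family L → ℕ → Set (suc ℓ)
RS 𝒯 ≡ n = RS≥ ω 𝒯 n × ¬ RS≥ ω 𝒯 (ℕ.suc n)

-- The ordinals range over all well-orders at level o.
RS_≡∞[_] : {L : Language ℓ} → Family L → (o : Level) → Set (suc ℓ ⊔ suc o)
RS 𝒯 ≡∞[ o ] = (W : WellOrder o) (α : WellOrder.Carrier W) → RS≥ W 𝒯 α

------------------------------------------------------------------------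
-- Languages with function symbols and the family of all their theories

record Signature (ℓ : Level) : Set (suc ℓ) where
  field
    PredSym   : Set ℓ
    predArity : PredSym → ℕ
    FunSym    : Set ℓ
    funArity  : FunSym → ℕ

module _ (Σ : Signature ℓ) where

  open Signature Σ

  record Structure : Set (suc ℓ) where
    field
      Carrier : Set ℓ
      point   : Carrier
      pred    : (P : PredSym) → Pred (Vec Carrier (predArity P)) ℓ
      fun     : (f : FunSym) → Vec Carrier (funArity f) → Carrier

  graphLanguage : Language ℓ
  graphLanguage .Symbol          = PredSym ⊎ FunSym
  graphLanguage .arity (inj₁ P)  = predArity P
  graphLanguage .arity (inj₂ f)  = ℕ.suc (funArity f)

  graphStructure : Structure → RelStructure graphLanguage
  graphStructure M = record
    { Carrier = Carrier
    ; point   = point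
    ; interp  = λ where
        (inj₁ P) v → pred P v
        (inj₂ f) v → fun f (init v) ≡ last v
    }
    where open Structure M

  AllTheories : Family graphLanguage
  AllTheories T = ∃ λ (M : Structure) → T ≐ Th (graphStructure M)

  FiniteMonadic : Set ℓ
  FiniteMonadic =
      (∃ λ k → PredSym ↔ Fin k)
    × (∃ λ m → FunSym ↔ Fin m)
    × (∀ P → predArity P ℕ.≤ 1)
    × (∀ f → funArity f ≡ 0)

{-# OPTIONS --safe #-}
module Submission where

-- Infinite rank: if the sentences σ i can be made true or false independently
-- of each other, then so can the remaining ones in the subfamily where σ n is
-- the first true sentence; these subfamilies are pairwise inconsistent, so every
-- ordinal is reached.  Infinitely many symbols give independent sentences
-- directly, and a symbol whose graph has arity at least 2 defines a unary
-- function, which can code a subset of ℕ by the depths of the leaves of a tree.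
--
-- Finite rank: replacing constants by their graphs leaves k symbols of arity at
-- most 1, which divide a structure into 2 ^ k cells.  A sentence of quantifier
-- rank at most q cannot distinguish cell sizes beyond q (an Ehrenfeucht–Fraïssé
-- argument).  By induction on d, a family whose members have fewer than d cells
-- of size at least q does not have rank ≥ d: among enough pairwise inconsistent
-- sentences, one excludes all members with the maximal number of large cells.

open import Defs
open import Axiom.ExcludedMiddle using (ExcludedMiddle)
open import Data.Bool.Base using (Bool; true; false; T; if_then_else_)
open import Data.Bool.Properties using (T-≡)
import Data.Empty.Polymorphic as Poly
open import Data.Fin.Base using (Fin; zero; suc; toℕ; fromℕ<; inject≤; funToFin; finToFun)
import Data.Fin.Properties as Fin
open import Data.Fin.Subset as Subset using (Subset; ∣_∣)
open import Data.Fin.Subset.Properties using (p⊂q⇒∣p∣<∣q∣; ∣p∣≤n)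
import Data.List.Base as List
import Data.List.Relation.Unary.Any.Properties as List
open import Data.Nat.Base as ℕ using (ℕ; zero; suc; _+_; _∸_; _≤_; _<_; z≤n; s≤s)
import Data.Nat.Properties as ℕ
open import Data.Product.Base using (Σ; ∃; _×_; _,_; proj₁; proj₂)
open import Data.Sum.Base using (_⊎_; inj₁; inj₂)
open import Data.Sum.Function.Propositional using (_⊎-↔_)
open import Data.Unit.Polymorphic.Base using (⊤; tt)
open import Data.Vec.Base using (Vec; []; _∷_; lookup; map; init; last; replicate; tabulate)
open import Data.Vec.Membership.Propositional using (_∈_; _∉_)
open import Data.Vec.Membership.Propositional.Properties using (∈-lookup)
open import Data.Vec.Properties using (lookup∘tabulate; []=⇒lookup; lookup⇒[]=)
import Data.Vec.Relation.Unary.All.Properties as All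
open import Data.Vec.Relation.Unary.AllPairs using ([]; _∷_)
open import Data.Vec.Relation.Unary.Any using (here; there; index)
open import Data.Vec.Relation.Unary.Any.Properties using (lookup-index)
open import Data.Vec.Relation.Unary.Unique.Propositional using (Unique)
open import Data.Vec.Relation.Unary.Unique.Propositional.Properties using (lookup-injective)
open import Function.Base using (_∘_; id; const)
open import Function.Bundles using (_⇔_; _↔_; mk⇔; mk↔ₛ′; module Equivalence; module Inverse)
open import Function.Definitions using (Injective)
import Function.Properties.Equivalence as ⇔
open import Function.Properties.Inverse using (↔-sym; ↔-trans)
open import Induction.WellFounded using (Acc; acc)
open import Level using (Level; Lift; lift; lower)
open import Relation.Binary.Definitions using (tri<; tri≈; tri>)
open import Relation.Binary.PropositionalEquality
  using (_≡_; _≢_; refl; sym; trans; cong; subst)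
open import Relation.Nullary.Decidable.Core using (yes; no; does; decidable-stable)
open import Relation.Nullary.Negation using (¬_; contradiction)
open import Relation.Unary using (_≐_)
open import Relation.Unary.Properties using (≐-sym; ≐-trans)

open Equivalence using (to; from)

private variable
  a b a′ b′ ℓ o : Level
  L : Language ℓ
  n : ℕ

module Classical (em : ∀ {a} → ExcludedMiddle a) where

  -- Consequences of excluded middle.

  dne : {A : Set a} → ¬ ¬ A → A
  dne = decidable-stable em

  truth : Set a → Bool
  truth A = does (em {P = A})

  T-truth : {A : Set a} → T (truth A) ⇔ A
  T-truth {A = A} with em {P = A}
  ... | yes p = mk⇔ (λ _ → p) _
  ... | no ¬p = mk⇔ (λ ()) ¬p

  -- A duplicate-free vector covering all of `A` would be a bijection with some `Fin k`, so every
  -- finite stage leaves a fresh element to add.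
  infinite⇒sequence : {A : Set a} → ¬ (∃ λ k → A ↔ Fin k) →
                      ∃ λ (p : ℕ → A) → Injective _≡_ _≡_ p
  infinite⇒sequence {A = A} infinite = p , p-injective
    where
    fresh : (xs : Vec A n) → Unique xs → ∃ (_∉ xs)
    fresh xs uniq = dne λ none → infinite
      (_ , mk↔ₛ′ (λ x → index (covered none x)) (lookup xs)
         (λ i → sym (lookup-injective uniq i _ (lookup-index (covered none _))))
         (λ x → sym (lookup-index (covered none x))))
      where
      covered : ¬ ∃ (_∉ xs) → ∀ x → x ∈ xs
      covered none x = dne λ x∉xs → none (x , x∉xs)

    initial : ∀ n → Σ (Vec A n) Unique
    initial zero    = [] , []
    initial (suc n) =
      let xs , uniq = initial n
          x , x∉xs  = fresh xs uniq
      in x ∷ xs ,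
         All.lookup⁻ (λ i eq → x∉xs (subst (_∈ xs) (sym eq) (∈-lookup i xs))) ∷ uniq

    p : ℕ → A
    p n = proj₁ (fresh _ (proj₂ (initial n)))

    p∈initial : ∀ {m n} → m ℕ.<′ n → p m ∈ proj₁ (initial n)
    p∈initial (ℕ.<′-base)     = here refl
    p∈initial (ℕ.<′-step m<n) = there (p∈initial m<n)

    p-≢ : ∀ {m n} → m < n → p m ≢ p n
    p-≢ {n = n} m<n eq =
      proj₂ (fresh _ (proj₂ (initial n)))
        (subst (_∈ proj₁ (initial n)) eq (p∈initial (ℕ.≤⇒≤′ m<n)))

    p-injective : Injective _≡_ _≡_ p
    p-injective {m} {n} eq with ℕ.<-cmp m n
    ... | tri< m<n _ _ = contradiction eq (p-≢ m<n)
    ... | tri≈ _ m≡n _ = m≡n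
    ... | tri> _ _ n<m = contradiction (sym eq) (p-≢ n<m)

  infix  8 ¬′_ ∃′_
  infixr 7 _∧′_

  ¬′_ : Formula L n → Formula L n
  ¬′ φ = φ ⇒ ⊥′

  _∧′_ : Formula L n → Formula L n → Formula L n
  φ ∧′ ψ = ¬′ (φ ⇒ ¬′ ψ)

  ∃′_ : Formula L (suc n) → Formula L n
  ∃′ φ = ¬′ all (¬′ φ)

  -- Sat M unfolds to the types on the left of the following equivalences.
  ¬-⇔ : {P : Set a} {Q : Set b} → P ⇔ Q → (P → Poly.⊥ {ℓ}) ⇔ (¬ Q)
  ¬-⇔ e = mk⇔ (λ f q → Poly.⊥-elim (f (from e q))) (λ f p → contradiction (to e p) f)

  ∧-⇔ : {P : Set a} {Q : Set b} {P′ : Set a′} {Q′ : Set b′} → P ⇔ Q → P′ ⇔ Q′ →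
        ((P → P′ → Poly.⊥ {ℓ}) → Poly.⊥ {ℓ}) ⇔ (Q × Q′)
  ∧-⇔ e e′ = mk⇔
    (λ f → dne λ g → Poly.⊥-elim (f λ p p′ → contradiction (to e p , to e′ p′) g))
    (λ (q , q′) f → f (from e q) (from e′ q′))

  ∃-⇔ : {A : Set a} {P : A → Set b} {Q : A → Set b′} → (∀ x → P x ⇔ Q x) →
        ((∀ x → P x → Poly.⊥ {ℓ}) → Poly.⊥ {ℓ}) ⇔ ∃ Q
  ∃-⇔ e = mk⇔
    (λ f → dne λ g → Poly.⊥-elim (f λ x p → contradiction (x , to (e x) p) g))
    (λ (x , q) f → f x (from (e x) q))

  -- Infinite rank from independent sentences.

  firstAt : (ℕ → Sentence L) → ℕ → Sentence L
  firstAt σ zero    = σ 0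
  firstAt σ (suc n) = ¬′ σ 0 ∧′ firstAt (σ ∘ suc) n

  sat-firstAt-suc : (M : RelStructure L) (σ : ℕ → Sentence L) → ∀ n →
    M ⊨ firstAt σ (suc n) ⇔ ((¬ M ⊨ σ 0) × M ⊨ firstAt (σ ∘ suc) n)
  sat-firstAt-suc M σ n = ∧-⇔ (¬-⇔ ⇔.refl) ⇔.refl

  firstAt-holds : (M : RelStructure L) (σ : ℕ → Sentence L) →
                  ∀ n → M ⊨ firstAt σ n → M ⊨ σ n
  firstAt-holds M σ zero    p = p
  firstAt-holds M σ (suc n) p =
    firstAt-holds M (σ ∘ suc) n (proj₂ (to (sat-firstAt-suc M σ n) p))

  firstAt-fails : (M : RelStructure L) (σ : ℕ → Sentence L) →
                  ∀ {m n} → m < n → M ⊨ firstAt σ n → ¬ M ⊨ σ m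
  firstAt-fails M σ {zero}  {suc n} _         p = proj₁ (to (sat-firstAt-suc M σ n) p)
  firstAt-fails M σ {suc m} {suc n} (s≤s m<n) p =
    firstAt-fails M (σ ∘ suc) m<n (proj₂ (to (sat-firstAt-suc M σ n) p))

  firstAt-inconsistent : (σ : ℕ → Sentence L) →
                         ∀ m n → m ≢ n → Inconsistent (firstAt σ m) (firstAt σ n)
  firstAt-inconsistent σ m n m≢n M (p , q) with ℕ.<-cmp m n
  ... | tri< m<n _ _ = firstAt-fails M σ m<n q (firstAt-holds M σ m p)
  ... | tri≈ _ m≡n _ = m≢n m≡n
  ... | tri> _ _ n<m = firstAt-fails M σ n<m p (firstAt-holds M σ n q)

  Realizes : RelStructure L → (ℕ → Sentence L) → (ℕ → Bool) → Set _
  Realizes M σ s = ∀ i → M ⊨ σ i ⇔ T (s i)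

  -- The values `s` placed behind `n` times false and one true: a model realizing them for `σ`
  -- satisfies `firstAt σ n`, while the sentences after `σ n` still follow `s`.
  firstTrueAt : ℕ → (ℕ → Bool) → ℕ → Bool
  firstTrueAt zero    s zero    = true
  firstTrueAt zero    s (suc i) = s i
  firstTrueAt (suc n) s zero    = false
  firstTrueAt (suc n) s (suc i) = firstTrueAt n s i

  firstTrueAt-after : ∀ n s i → firstTrueAt n s (suc (n + i)) ≡ s i
  firstTrueAt-after zero    s i = refl
  firstTrueAt-after (suc n) s i = firstTrueAt-after n s i

  realizes⇒firstAt : (M : RelStructure L) (σ : ℕ → Sentence L) →
                     ∀ n {s} → Realizes M σ (firstTrueAt n s) → M ⊨ firstAt σ n
  realizes⇒firstAt M σ zero    r = from (r 0) _
  realizes⇒firstAt M σ (suc n) r = from (sat-firstAt-suc M σ n)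
    (to (r 0) , realizes⇒firstAt M (σ ∘ suc) n (r ∘ suc))

  Independent : {L : Language ℓ} → Family L → (ℕ → Sentence L) → Set _
  Independent {L = L} 𝒯 σ =
    ∀ s → ∃ λ (M : RelStructure L) → 𝒯 (Th M) × Realizes M σ s

  independent-↾ : (𝒯 : Family L) (σ : ℕ → Sentence L) → Independent 𝒯 σ →
                  ∀ n → Independent (𝒯 ↾ firstAt σ n) (λ i → σ (suc (n + i)))
  independent-↾ 𝒯 σ indep n s with M , M∈𝒯 , r ← indep (firstTrueAt n s) =
    M , (M∈𝒯 , realizes⇒firstAt M σ n r) ,
    λ i → subst (λ b → M ⊨ σ (suc (n + i)) ⇔ T b)
                (firstTrueAt-after n s i) (r (suc (n + i)))

  -- Well-founded induction on `α`, with `𝒯` and `σ` generalized because the successor step passes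
  -- to a subfamily and to a tail of `σ`.
  independent⇒RS∞ : (𝒯 : Family L) (σ : ℕ → Sentence L) →
                    Independent 𝒯 σ → RS 𝒯 ≡∞[ o ]
  independent⇒RS∞ {L = L} 𝒯 σ indep W α = go 𝒯 σ indep (W.wellFounded α)
    where
    module W = WellOrder W

    go : (𝒯 : Family L) (σ : ℕ → Sentence L) → Independent 𝒯 σ →
         ∀ {α} → Acc W._<_ α → RS≥ W 𝒯 α
    go 𝒯 σ indep {α} (acc rec) with em {P = W.IsZero α} | em {P = ∃ (W.IsSucc α)}
    ... | yes z | _           = ≥zero z (_ , proj₁ (proj₂ (indep (const true))))
    ... | no _  | yes (_ , s) = ≥succ s (firstAt σ) (firstAt-inconsistent σ)
                                  λ n → go _ (λ i → σ (suc (n + i)))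
                                            (independent-↾ 𝒯 σ indep n) (rec (proj₁ s))
    ... | no ¬z | no ¬s       = ≥limit (¬z , λ β s → ¬s (β , s))
                                  λ _ β<α → go 𝒯 σ indep (rec β<α)

  -- Languages that are not finite monadic.

  module Infinite {ℓ : Level} (Sg : Signature ℓ) where

    open Signature Sg

    L₀ : Language ℓ
    L₀ = graphLanguage Sg

    Th∈AllTheories : (M : Structure Sg) → AllTheories Sg (Th (graphStructure Sg M))
    Th∈AllTheories M = M , id , id

    -- In a one-point structure every predicate is a mere truth value, so the `p i` can be switched
    -- independently. The quantifier supplies a variable for any arity.
    infinitelyManyPredicates : ¬ (∃ λ k → PredSym ↔ Fin k) → RS AllTheories Sg ≡∞[ o ]
    infinitelyManyPredicates infinite with p , p-injective ← infinite⇒sequence infinite =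
      independent⇒RS∞ _ (λ i → all (rel (inj₁ (p i)) (replicate _ zero))) λ s →
        graphStructure Sg (M s) , Th∈AllTheories (M s) , λ i → mk⇔
          (λ h → chosen s (h tt))
          (λ si _ → i , refl , si)
      where
      M : (ℕ → Bool) → Structure Sg
      M s = record
        { Carrier = ⊤
        ; point   = tt
        ; pred    = λ P _ → ∃ λ i → p i ≡ P × T (s i)
        ; fun     = λ _ _ → tt
        }

      chosen : ∀ s {i} → (∃ λ j → p j ≡ p i × T (s j)) → T (s i)
      chosen s (j , eq , sj) = subst (T ∘ s) (p-injective eq) sj

    last-map-replicate : {A : Set a} {B : Set b} (f : A → B) (x : A) →
                         ∀ n → last (map f (replicate (suc n) x)) ≡ f x
    last-map-replicate f x zero    = refl
    last-map-replicate f x (suc n) = last-map-replicate f x n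

    -- All functions are constant, with value true for p 0 and with value s i for
    -- p (suc i).
    infinitelyManyFunctions : ¬ (∃ λ k → FunSym ↔ Fin k) → RS AllTheories Sg ≡∞[ o ]
    infinitelyManyFunctions infinite with p , p-injective ← infinite⇒sequence infinite =
      independent⇒RS∞ _ (λ i → all (graph (p (suc i)) ⇒ graph (p 0))) λ s →
        graphStructure Sg (M s) , Th∈AllTheories (M s) , λ i → mk⇔
          (λ h → let eq = to (sat-graph s (p 0) _)
                            (h _ (from (sat-graph s (p (suc i)) _) refl))
                 in to (T-value s (suc i)) (subst (T ∘ lower) eq (from (T-value s 0) _)))
          (λ si x e → from (sat-graph s (p 0) x)
             (trans (cong lift (trans (to T-≡ (from (T-value s 0) _))
                                      (sym (to T-≡ (from (T-value s (suc i)) si)))))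
                    (to (sat-graph s (p (suc i)) x) e)))
      where
      graph : ∀ f → Formula L₀ 1
      graph f = rel (inj₂ f) (replicate _ zero)

      value : (ℕ → Bool) → FunSym → Lift ℓ Bool
      value s f = lift (truth (∃ λ i → p i ≡ f × T (firstTrueAt 0 s i)))

      M : (ℕ → Bool) → Structure Sg
      M s = record
        { Carrier = Lift ℓ Bool
        ; point   = lift true
        ; pred    = λ _ _ → ⊤
        ; fun     = λ f _ → value s f
        }

      sat-graph : ∀ s f x → Sat (graphStructure Sg (M s)) (graph f) (x ∷ []) ⇔ value s f ≡ x
      sat-graph s f x = mk⇔ (λ e → trans e eq) (λ e → trans e (sym eq))
        where eq = last-map-replicate (lookup (x ∷ [])) zero (funArity f)

      T-value : ∀ s i → T (lower (value s (p i))) ⇔ T (firstTrueAt 0 s i)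
      T-value s i = mk⇔
        (λ t → chosen (to T-truth t))
        (λ si → from T-truth (i , refl , si))
        where
        chosen : (∃ λ j → p j ≡ p i × T (firstTrueAt 0 s j)) → T (firstTrueAt 0 s i)
        chosen (j , eq , sj) = subst (T ∘ firstTrueAt 0 s) (p-injective eq) sj

    -- Repeating `y` makes it the last argument at every arity from 2 on, so that any such symbol
    -- serves as a binary relation.
    edgeArgs : ∀ m → Fin n → Fin n → Vec (Fin n) m
    edgeArgs zero    x y = []
    edgeArgs (suc m) x y = x ∷ replicate m y

    -- A function on ℕ × Bool: the points (k , false) form the chain
    -- 0 ← 1 ← 2 ← …, rooted at a fixed point, and (k , true) is a leaf, of
    -- depth k + 2 if s k holds and of depth 1 otherwise.
    module Forest (s : ℕ → Bool) where

      Node : Set ℓ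
      Node = Lift ℓ (ℕ × Bool)

      depth : Node → ℕ
      depth (lift (k , false)) = k
      depth (lift (k , true))  = suc (if s k then suc k else 0)

      step : Node → Node
      step x = lift (depth x ∸ 1 , false)

      step-fixed : ∀ x → step x ≡ x ⇔ depth x ≤ 0
      step-fixed x = mk⇔ (λ e → shrinks (depth x) (cong depth e)) (fixed x)
        where
        shrinks : ∀ d → d ∸ 1 ≡ d → d ≤ 0
        shrinks zero    _ = z≤n
        shrinks (suc d) e = contradiction (sym e) ℕ.1+n≢n

        fixed : ∀ x → depth x ≤ 0 → step x ≡ x
        -- Leaves have positive depth, so only the root remains.
        fixed (lift (zero , false)) _ = refl

      stepAt : Vec Node n → Node
      stepAt []      = lift (0 , false)
      stepAt (x ∷ _) = step x

      stepsTo : Vec Node n → Set ℓ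
      stepsTo []      = ⊤
      stepsTo (x ∷ v) = step x ≡ last (x ∷ v)

      forest : Structure Sg
      forest = record
        { Carrier = Node
        ; point   = lift (0 , false)
        ; pred    = λ P → stepsTo
        ; fun     = λ f → stepAt
        }

      M : RelStructure L₀
      M = graphStructure Sg forest

      -- A function symbol of positive arity is interpreted by the step of the
      -- first argument, a predicate symbol of arity ≥ 2 by the relation between
      -- the first and the last argument, so that on edgeArgs both give step.
      interp-edgeArgs : ∀ R → 2 ≤ arity L₀ R → (x y : Fin n) (ρ : Vec Node n) →
        RelStructure.interp M R (map (lookup ρ) (edgeArgs _ x y)) ⇔
        step (lookup ρ x) ≡ lookup ρ y
      interp-edgeArgs (inj₁ P) 2≤m x y ρ = predicate (predArity P) 2≤m
        where
        predicate : ∀ m → 2 ≤ m → stepsTo (map (lookup ρ) (edgeArgs m x y)) ⇔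
                    step (lookup ρ x) ≡ lookup ρ y
        predicate (suc (suc m)) _ = mk⇔ (λ e → trans e eq) (λ e → trans e (sym eq))
          where eq = last-map-replicate (lookup ρ) y m
        predicate (suc zero) (s≤s ())
      interp-edgeArgs (inj₂ f) (s≤s 1≤m) x y ρ = function (funArity f) 1≤m
        where
        function : ∀ m → 1 ≤ m → let v = map (lookup ρ) (edgeArgs (suc m) x y) in
                   stepAt (init v) ≡ last v ⇔ step (lookup ρ x) ≡ lookup ρ y
        function (suc m) _ = mk⇔ (λ e → trans e eq) (λ e → trans e (sym eq))
          where eq = last-map-replicate (lookup ρ) y m

    module Edges (R : Symbol L₀) (2≤arity : 2 ≤ arity L₀ R) where

      edge : Fin n → Fin n → Formula L₀ n
      edge x y = rel R (edgeArgs _ x y)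

      -- `step` lowers the depth by at least one until it reaches the root, its only fixed point;
      -- this makes depth definable from `edge`.
      depth≤ : ℕ → Fin n → Formula L₀ n
      depth≤ zero    x = edge x x
      depth≤ (suc d) x = ∃′ (edge (suc x) zero ∧′ depth≤ d zero)

      -- The values of `step` are exactly the chain points, since `(k + 1 , false)` steps to
      -- `(k , false)`.
      nonLeaf : Formula L₀ 1
      nonLeaf = ∃′ edge zero (suc zero)

      -- The leaf `(i , true)` has depth `2 + i` if `s i` holds; a leaf that is switched off has
      -- depth 1, which the offset 2 avoids.
      leafOfDepth : ℕ → Formula L₀ 1
      leafOfDepth i = ¬′ nonLeaf ∧′ depth≤ (2 + i) zero ∧′ ¬′ depth≤ (1 + i) zero

      module _ (s : ℕ → Bool) where

        open Forest s

        sat-edge : (x y : Fin n) (ρ : Vec Node n) →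
                   Sat M (edge x y) ρ ⇔ step (lookup ρ x) ≡ lookup ρ y
        sat-edge = interp-edgeArgs R 2≤arity

        sat-depth≤ : ∀ d (x : Fin n) (ρ : Vec Node n) →
                     Sat M (depth≤ d x) ρ ⇔ depth (lookup ρ x) ≤ d
        sat-depth≤ zero    x ρ = ⇔.trans (sat-edge x x ρ) (step-fixed (lookup ρ x))
        sat-depth≤ (suc d) x ρ = ⇔.trans
          (∃-⇔ λ y → ∧-⇔ (sat-edge (suc x) zero (y ∷ ρ)) (sat-depth≤ d zero (y ∷ ρ)))
          (mk⇔ (λ (y , e , y≤d) → ℕ.≤-trans (ℕ.m≤n+m∸n _ 1)
                                    (s≤s (subst (λ z → depth z ≤ d) (sym e) y≤d)))
               (λ x≤1+d → step (lookup ρ x) , refl , ℕ.∸-monoˡ-≤ 1 x≤1+d))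

        sat-leafOfDepth : ∀ i x → Sat M (leafOfDepth i) (x ∷ []) ⇔
          ((¬ ∃ λ y → step y ≡ x) × depth x ≤ 2 + i × ¬ depth x ≤ 1 + i)
        sat-leafOfDepth i x =
          ∧-⇔ (¬-⇔ (∃-⇔ λ y → sat-edge zero (suc zero) (y ∷ x ∷ [])))
              (∧-⇔ (sat-depth≤ (2 + i) zero (x ∷ []))
                   (¬-⇔ (sat-depth≤ (1 + i) zero (x ∷ []))))

        leafAtDepth : ∀ i x → ¬ (∃ λ y → step y ≡ x) → depth x ≡ 2 + i → T (s i)
        leafAtDepth i (lift (k , false)) leaf _ =
          contradiction (lift (suc k , false) , refl) leaf
        leafAtDepth i (lift (k , true)) _ e with s k in eq
        leafAtDepth i (lift (k , true)) _ refl | true = subst T (sym eq) _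

        leaf : ∀ i → ¬ ∃ λ y → step y ≡ lift (i , true)
        leaf i ()

        depth-leaf : ∀ i → T (s i) → depth (lift (i , true)) ≡ 2 + i
        depth-leaf i si with true ← s i = refl

        realizes : Realizes M (λ i → ∃′ leafOfDepth i) s
        realizes i = ⇔.trans (∃-⇔ (sat-leafOfDepth i)) (mk⇔
          (λ (x , l , ≤2+i , ≰1+i) →
             leafAtDepth i x l (ℕ.≤-antisym ≤2+i (ℕ.≰⇒> ≰1+i)))
          (λ si → let e = depth-leaf i si in
             lift (i , true) , leaf i , ℕ.≤-reflexive e ,
             λ ≤1+i → ℕ.<⇒≱ (ℕ.≤-reflexive (sym e)) ≤1+i))

    nonMonadic : ∀ R → 2 ≤ arity L₀ R → RS AllTheories Sg ≡∞[ o ]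
    nonMonadic R 2≤arity = independent⇒RS∞ _ (λ i → ∃′ Edges.leafOfDepth R 2≤arity i) λ s →
      Forest.M s , Th∈AllTheories (Forest.forest s) , Edges.realizes R 2≤arity s

  -- Quantifier rank and finite coding.

  qrank : Formula L n → ℕ
  qrank ⊥′        = 0
  qrank (x ≈ y)   = 0
  qrank (rel R _) = 0
  qrank (φ ⇒ ψ)   = qrank φ ℕ.⊔ qrank ψ
  qrank (all φ)   = suc (qrank φ)

  -- Truth values in `Fin 2` can be packed by `funToFin`, finitely many into one number.
  truthBit : Set a → Fin 2
  truthBit A = if truth A then suc zero else zero

  truthBit-≡ : {A : Set a} {B : Set b} → truthBit A ≡ truthBit B → A → B
  truthBit-≡ {A = A} {B = B} eq x with em {P = A} | em {P = B}
  ... | _     | yes y = y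
  ... | no ¬x | no _  = contradiction x ¬x
  truthBit-≡ () x | yes _ | no _

  funToFin-injective : ∀ {m n} (f g : Fin m → Fin n) →
                       funToFin f ≡ funToFin g → ∀ i → f i ≡ g i
  funToFin-injective f g eq i =
    trans (sym (Fin.finToFun-funToFin f i))
          (trans (cong (λ c → finToFun c i) eq) (Fin.finToFun-funToFin g i))

  upperBound : (f : ℕ → ℕ) → ∀ n → ∃ λ b → ∀ {i} → i < n → f i ≤ b
  upperBound f zero    = 0 , λ ()
  upperBound f (suc n) = let b , f≤b = upperBound f n in
    f n ℕ.⊔ b , λ i<1+n → step f≤b (ℕ.m<1+n⇒m<n∨m≡n i<1+n)
    where
    step : ∀ {i b} → (i < n → f i ≤ b) → i < n ⊎ i ≡ n → f i ≤ f n ℕ.⊔ b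
    step f≤b (inj₁ i<n)  = ℕ.≤-trans (f≤b i<n) (ℕ.m≤n⊔m (f n) _)
    step f≤b (inj₂ refl) = ℕ.m≤m⊔n (f n) _

  -- Turns an upper bound on the rank into its value: `RS 𝒯 ≡ m` asks for exactly such a pair.
  lastTrue : (P : ℕ → Set a) → P 0 → ∀ n → ¬ P n → ∃ λ m → P m × ¬ P (suc m)
  lastTrue P p₀ zero    ¬p = contradiction p₀ ¬p
  lastTrue P p₀ (suc n) ¬p with em {P = P n}
  ... | yes p = n , p , ¬p
  ... | no ¬p = lastTrue P p₀ n ¬p

  -- Cells and the Ehrenfeucht-Fraïssé game.

  module Monadic {L : Language ℓ} {k : ℕ} (Symbol↔Fin : Symbol L ↔ Fin k)
                 (monadic : ∀ R → arity L R ≤ 1) where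

    open RelStructure

    cells : ℕ
    cells = 2 ℕ.^ k

    -- A 0-ary symbol contributes the same bit to the cells of all elements, so
    -- its truth value is visible in any nonempty cell.
    cell : (M : RelStructure L) → Carrier M → Fin cells
    cell M a = funToFin λ i →
      truthBit (interp M (Inverse.from Symbol↔Fin i) (replicate _ a))

    cell-≡ : ∀ M N {a b} → cell M a ≡ cell N b →
             ∀ R → interp M R (replicate _ a) → interp N R (replicate _ b)
    cell-≡ M N {a} {b} eq R =
      subst (λ R → interp M R (replicate _ a) → interp N R (replicate _ b))
            (Inverse.strictlyInverseʳ Symbol↔Fin R)
            (truthBit-≡ (funToFin-injective _ _ eq (Inverse.to Symbol↔Fin R)))

    record AtLeast (M : RelStructure L) (c : Fin cells) (j : ℕ) : Set ℓ where
      constructor atLeast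
      field
        element   : Fin j → Carrier M
        injective : Injective _≡_ _≡_ element
        inCell    : ∀ i → cell M (element i) ≡ c

    open AtLeast

    AtLeast-≤ : ∀ {M c i j} → i ≤ j → AtLeast M c j → AtLeast M c i
    AtLeast-≤ i≤j (atLeast f f-injective f∈c) = atLeast
      (λ t → f (inject≤ t i≤j))
      (λ eq → Fin.inject≤-injective i≤j i≤j _ _ (f-injective eq))
      (λ t → f∈c (inject≤ t i≤j))

    AtLeast-suc : ∀ {M c j} (xs : AtLeast M c j) (a : Carrier M) →
                  cell M a ≡ c → (∀ i → xs .element i ≢ a) → AtLeast M c (suc j)
    AtLeast-suc {M} {c} {j} (atLeast f f-injective f∈c) a a∈c a∉f =
      atLeast g g-injective g∈c
      where
      g : Fin (suc j) → Carrier M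
      g zero    = a
      g (suc i) = f i

      g-injective : Injective _≡_ _≡_ g
      g-injective {zero}  {zero}  eq = refl
      g-injective {zero}  {suc i} eq = contradiction (sym eq) (a∉f i)
      g-injective {suc i} {zero}  eq = contradiction eq (a∉f i)
      g-injective {suc i} {suc j} eq = cong suc (f-injective eq)

      g∈c : ∀ i → cell M (g i) ≡ c
      g∈c zero    = a∈c
      g∈c (suc i) = f∈c i

    -- Corresponding cells have equal sizes or both have at least `q` elements.
    record Agree (q : ℕ) (M N : RelStructure L) : Set ℓ where
      constructor agreeing
      field
        atLeast-⇔ : ∀ c j → j ≤ q → AtLeast M c j ⇔ AtLeast N c j

    open Agree

    Agree-sym : ∀ {q M N} → Agree q M N → Agree q N M
    Agree-sym agree .atLeast-⇔ c j j≤q = ⇔.sym (agree .atLeast-⇔ c j j≤q)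

    -- A position of the game: `ρ` and `ρ′` list the elements chosen so far.
    record Similar (M N : RelStructure L) {n} (ρ : Vec (Carrier M) n)
                   (ρ′ : Vec (Carrier N) n) : Set ℓ where
      field
        cell-lookup : ∀ i → cell M (lookup ρ i) ≡ cell N (lookup ρ′ i)
        ≡-lookup    : ∀ i j → lookup ρ i ≡ lookup ρ j ⇔ lookup ρ′ i ≡ lookup ρ′ j

    open Similar

    Similar-sym : ∀ {M N n} {ρ : Vec _ n} {ρ′ : Vec _ n} →
                  Similar M N ρ ρ′ → Similar N M ρ′ ρ
    Similar-sym s .cell-lookup i = sym (s .cell-lookup i)
    Similar-sym s .≡-lookup i j  = ⇔.sym (s .≡-lookup i j)

    Similar-∷ : ∀ {M N n} {ρ : Vec _ n} {ρ′ : Vec _ n} {a b} → Similar M N ρ ρ′ →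
                cell M a ≡ cell N b → (∀ i → a ≡ lookup ρ i ⇔ b ≡ lookup ρ′ i) →
                Similar M N (a ∷ ρ) (b ∷ ρ′)
    Similar-∷ s eq e .cell-lookup zero          = eq
    Similar-∷ s eq e .cell-lookup (suc i)       = s .cell-lookup i
    Similar-∷ s eq e .≡-lookup zero    zero     = mk⇔ (λ _ → refl) (λ _ → refl)
    Similar-∷ s eq e .≡-lookup zero    (suc j)  = e j
    Similar-∷ s eq e .≡-lookup (suc i) zero     =
      mk⇔ (sym ∘ to (e i) ∘ sym) (sym ∘ from (e i) ∘ sym)
    Similar-∷ s eq e .≡-lookup (suc i) (suc j)  = s .≡-lookup i j

    -- If the cell of a had no new element in N, then any j elements of that
    -- cell in N would come with j preimages in M, to which a can be added;
    -- climbing from j = 0 to j = n + 1 this contradicts the pigeonhole principle.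
    extend : ∀ {q M N n} {ρ : Vec _ n} {ρ′ : Vec _ n} → Agree q M N → n < q →
             Similar M N ρ ρ′ → ∀ a → ∃ λ b → Similar M N (a ∷ ρ) (b ∷ ρ′)
    extend {q} {M} {N} {n} {ρ} {ρ′} agree n<q s a with em {P = ∃ λ i → lookup ρ i ≡ a}
    ... | yes (i , refl) = lookup ρ′ i , Similar-∷ s (s .cell-lookup i) (s .≡-lookup i)
    ... | no a∉ρ = let b , b∈c , b∉ρ′ = fresh in
      b , Similar-∷ s (sym b∈c) λ i →
        mk⇔ (λ a≡ → contradiction (i , sym a≡) a∉ρ)
            (λ b≡ → contradiction (i , sym b≡) b∉ρ′)
      where
      c = cell M a

      Fresh : Set ℓ
      Fresh = ∃ λ b → cell N b ≡ c × ¬ ∃ λ i → lookup ρ′ i ≡ b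

      source : ¬ Fresh → ∀ {b} → cell N b ≡ c → ∃ λ i → lookup ρ′ i ≡ b
      source none b∈c = dne λ b∉ρ′ → none (_ , b∈c , b∉ρ′)

      climb : ¬ Fresh → ∀ j → j ≤ suc n → AtLeast N c j
      climb none zero    _   = atLeast (λ ()) (λ {}) (λ ())
      climb none (suc j) 1+j≤1+n = to (agree .atLeast-⇔ c (suc j) (ℕ.≤-trans 1+j≤1+n n<q))
        (AtLeast-suc (atLeast (lookup ρ ∘ i) i-injective i∈c) a refl
                     (λ t eq → a∉ρ (i t , eq)))
        where
        previous = climb none j (ℕ.<⇒≤ 1+j≤1+n)
        f = previous .element

        i : Fin j → Fin n
        i t = proj₁ (source none (previous .inCell t))

        ρ′i≡f : ∀ t → lookup ρ′ (i t) ≡ f t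
        ρ′i≡f t = proj₂ (source none (previous .inCell t))

        i-injective : Injective _≡_ _≡_ (lookup ρ ∘ i)
        i-injective {t} {u} eq = previous .injective
          (trans (sym (ρ′i≡f t)) (trans (to (s .≡-lookup (i t) (i u)) eq) (ρ′i≡f u)))

        i∈c : ∀ t → cell M (lookup ρ (i t)) ≡ c
        i∈c t = trans (s .cell-lookup (i t))
                      (trans (cong (cell N) (ρ′i≡f t)) (previous .inCell t))

      fresh : Fresh
      fresh = dne λ none →
        let atLeast f f-injective f∈c = climb none (suc n) ℕ.≤-refl
            t , u , t<u , it≡iu   =
              Fin.pigeonhole ℕ.≤-refl (λ t → proj₁ (source none (f∈c t)))
        in contradiction
             (f-injective (trans (sym (proj₂ (source none (f∈c t))))
                (trans (cong (lookup ρ′) it≡iu) (proj₂ (source none (f∈c u))))))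
             (Fin.<⇒≢ t<u)

    sat-rel : ∀ {q M N n} {ρ : Vec _ n} {ρ′ : Vec _ n} → Agree q M N → 1 ≤ q →
              Similar M N ρ ρ′ → ∀ R (xs : Vec (Fin n) (arity L R)) →
              Sat M (rel R xs) ρ → Sat N (rel R xs) ρ′
    sat-rel {q} {M} {N} {n} {ρ} {ρ′} agree 1≤q s R xs p =
      let a , b , eq , xs-a , xs-b = constant (monadic R) xs
      in subst (interp N R) (sym xs-b)
           (cell-≡ M N eq R (subst (interp M R) xs-a p))
      where
      constant : ∀ {m} → m ≤ 1 → (xs : Vec (Fin n) m) → ∃ λ a → ∃ λ b →
                 cell M a ≡ cell N b × map (lookup ρ) xs ≡ replicate m a ×
                 map (lookup ρ′) xs ≡ replicate m b
      -- A 0-ary symbol is read off the cell of `point M`, which has an element in `N` because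
      -- `1 ≤ q`.
      constant _ []       =
        let atLeast f _ f∈c = to (agree .atLeast-⇔ (cell M (point M)) 1 1≤q)
              (atLeast (λ _ → point M) (λ { {zero} {zero} _ → refl }) (λ _ → refl))
        in point M , f zero , sym (f∈c zero) , refl , refl
      constant _ (x ∷ []) = lookup ρ x , lookup ρ′ x , s .cell-lookup x , refl , refl
      constant (s≤s ()) (_ ∷ _ ∷ _)

    -- With `n` elements chosen and at most `qrank φ` rounds to come, every quantifier is met while
    -- fewer than `q` elements are chosen, so `extend` answers it.
    agree⇒sat⇔ : ∀ {q M N n} {ρ : Vec _ n} {ρ′ : Vec _ n} → Agree q M N → 1 ≤ q →
                 Similar M N ρ ρ′ → (φ : Formula L n) → n + qrank φ ≤ q →
                 Sat M φ ρ ⇔ Sat N φ ρ′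
    agree⇒sat⇔ ag 1≤q s ⊥′         _ = mk⇔ (λ ()) (λ ())
    agree⇒sat⇔ ag 1≤q s (x ≈ y)    _ = s .≡-lookup x y
    agree⇒sat⇔ ag 1≤q s (rel R xs) _ =
      mk⇔ (sat-rel ag 1≤q s R xs)
          (sat-rel (Agree-sym ag) 1≤q (Similar-sym s) R xs)
    agree⇒sat⇔ {n = n} ag 1≤q s (φ ⇒ ψ) n+r≤q =
      mk⇔ (λ f p → to ihψ (f (from ihφ p))) (λ f p → from ihψ (f (to ihφ p)))
      where
      ihφ = agree⇒sat⇔ ag 1≤q s φ
        (ℕ.≤-trans (ℕ.+-monoʳ-≤ n (ℕ.m≤m⊔n (qrank φ) (qrank ψ))) n+r≤q)
      ihψ = agree⇒sat⇔ ag 1≤q s ψ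
        (ℕ.≤-trans (ℕ.+-monoʳ-≤ n (ℕ.m≤n⊔m (qrank φ) (qrank ψ))) n+r≤q)
    agree⇒sat⇔ {q} {n = n} ag 1≤q s (all φ) n+r≤q = mk⇔
      (λ f b → let a , s′ = extend (Agree-sym ag) n<q (Similar-sym s) b
               in to (agree⇒sat⇔ ag 1≤q (Similar-sym s′) φ 1+n+r≤q) (f a))
      (λ f a → let b , s′ = extend ag n<q s a
               in from (agree⇒sat⇔ ag 1≤q s′ φ 1+n+r≤q) (f b))
      where
      1+n+r≤q : suc n + qrank φ ≤ q
      1+n+r≤q = subst (_≤ q) (ℕ.+-suc n (qrank φ)) n+r≤q
      n<q : n < q
      n<q = ℕ.m+n≤o⇒m≤o (suc n) 1+n+r≤q

    agree⇒⊨ : ∀ {q M N} → Agree q M N → 1 ≤ q → (φ : Sentence L) → qrank φ ≤ q →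
              M ⊨ φ → N ⊨ φ
    agree⇒⊨ ag 1≤q φ r≤q =
      to (agree⇒sat⇔ ag 1≤q (record { cell-lookup = λ (); ≡-lookup = λ () }) φ r≤q)

    -- Codes of cell sizes and large cells.

    codes : ℕ → ℕ
    codes q = (2 ℕ.^ suc q) ℕ.^ cells

    sizeBits : ∀ q → RelStructure L → Fin cells → Fin (suc q) → Fin 2
    sizeBits q M c j = truthBit (AtLeast M c (toℕ j))

    -- One bit for each cell and each `j ≤ q` records all sizes up to `q`; that there are finitely
    -- many codes enables the pigeonhole argument.
    code : ∀ q → RelStructure L → Fin (codes q)
    code q M = funToFin λ c → funToFin (sizeBits q M c)

    code-≡ : ∀ {q M N} → code q M ≡ code q N →
             ∀ c j → j ≤ q → AtLeast M c j → AtLeast N c j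
    code-≡ {q} {M} {N} eq c j j≤q =
      subst (λ j → AtLeast M c j → AtLeast N c j) (Fin.toℕ-fromℕ< (s≤s j≤q))
        (truthBit-≡ (funToFin-injective (sizeBits q M c) (sizeBits q N c)
                       (funToFin-injective _ _ eq c) (fromℕ< (s≤s j≤q))))

    large : ℕ → RelStructure L → Subset cells
    large q M = tabulate λ c → truth (AtLeast M c q)

    ∈-large : ∀ {q M c} → c Subset.∈ large q M ⇔ AtLeast M c q
    ∈-large {q} {M} {c} = mk⇔
      (λ c∈ → to T-truth (from T-≡ (trans (sym (lookup∘tabulate _ c)) ([]=⇒lookup c∈))))
      (λ p → lookup⇒[]= c _ (trans (lookup∘tabulate _ c) (to T-≡ (from T-truth p))))

    -- For q ≤ q′ this forces large q′ M and large q M to coincide.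
    record Generic (d q q′ : ℕ) (M : RelStructure L) : Set ℓ where
      constructor generic
      field
        few  : ∣ large q M ∣ ≤ d
        many : d ≤ ∣ large q′ M ∣

    -- Otherwise `c` would make the inclusion of `large q′ M` in `large q M` strict, against `few`
    -- and `many`.
    generic-grows : ∀ {d q q′ M c} → q ≤ q′ → Generic d q q′ M →
                    AtLeast M c q → AtLeast M c q′
    generic-grows {q = q} {q′} {M} {c} q≤q′ (generic few many) p = dne λ ¬p′ →
      ℕ.<⇒≱ (p⊂q⇒∣p∣<∣q∣ {p = large q′ M}
               ( (λ x → from ∈-large (AtLeast-≤ q≤q′ (to ∈-large x)))
               , c , from ∈-large p , λ x → ¬p′ (to ∈-large x)))
            (ℕ.≤-trans few many)

    -- Up to `q` the codes decide; a cell with `q` elements in one structure has `q` in the other,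
    -- and there even `q′`.
    generic-agree : ∀ {d q q′ M N} → q ≤ q′ → Generic d q q′ M → Generic d q q′ N →
                    code q M ≡ code q N → Agree q′ M N
    generic-agree {q = q} {q′} q≤q′ gM gN eq = agreeing λ c j j≤q′ → mk⇔
      (transfer gN eq c j j≤q′) (transfer gM (sym eq) c j j≤q′)
      where
      transfer : ∀ {d M N} → Generic d q q′ N → code q M ≡ code q N →
                 ∀ c j → j ≤ q′ → AtLeast M c j → AtLeast N c j
      transfer gN eq c j j≤q′ p with ℕ.≤-total j q
      ... | inj₁ j≤q = code-≡ eq c j j≤q p
      ... | inj₂ q≤j = AtLeast-≤ j≤q′ (generic-grows q≤q′ gN
                         (code-≡ eq c q ℕ.≤-refl (AtLeast-≤ q≤j p)))

    -- Bounding the rank by the number of cells.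

    Bounded : ℕ → ℕ → Family L → Set _
    Bounded q d 𝒯 = ∀ T → 𝒯 T → ∃ λ M → T ≐ Th M × ∣ large q M ∣ < d

    -- Each theory has a model in which no cell has `q` elements. Its code at `q` gives all cell
    -- sizes and hence the theory, so one theory per code suffices.
    bounded⇒finite : ∀ {q 𝒯} → Bounded q 1 𝒯 → FiniteFamily 𝒯
    bounded⇒finite {q} {𝒯} bounded = List.tabulate theory , λ T T∈𝒯 →
      let M , T≐M , few = bounded T T∈𝒯
      in List.tabulate⁺ (code q M) (theory-code (T , T∈𝒯 , M , T≐M , few , refl))
      where
      Coded : Fin (codes q) → Set _
      Coded c = ∃ λ T → 𝒯 T × ∃ λ M → T ≐ Th M × ∣ large q M ∣ < 1 × code q M ≡ c

      theory : Fin (codes q) → Theory L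
      theory c with em {P = Coded c}
      ... | yes (T , _) = T
      ... | no _        = λ _ → Poly.⊥

      coded-⊆ : ∀ {M N} → ∣ large q M ∣ < 1 → ∣ large q N ∣ < 1 →
                code q M ≡ code q N → ∀ {φ} → M ⊨ φ → N ⊨ φ
      coded-⊆ {M} {N} (s≤s fewM) (s≤s fewN) eq {φ} = agree⇒⊨
        -- For `d = 0` both structures are generic at every `q′`, so `q′` can be taken above the
        -- quantifier rank of `φ`.
        (generic-agree {q′ = suc (q + qrank φ)} (ℕ.m≤n⇒m≤1+n (ℕ.m≤m+n q _))
                       (generic fewM z≤n) (generic fewN z≤n) eq)
        (s≤s z≤n) φ (ℕ.m≤n⇒m≤1+n (ℕ.m≤n+m _ q))

      theory-code : ∀ {c} ((T , _) : Coded c) → T ≐ theory c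
      theory-code {c} (T , T∈𝒯 , M , T≐M , fewM , eqM) with em {P = Coded c}
      ... | yes (T′ , _ , N , T′≐N , fewN , eqN) = ≐-trans T≐M (≐-trans
              ( (λ {φ} → coded-⊆ fewM fewN (trans eqM (sym eqN)) {φ})
              , (λ {φ} → coded-⊆ fewN fewM (trans eqN (sym eqM)) {φ}))
              (≐-sym T′≐N))
      ... | no none = contradiction (T , T∈𝒯 , M , T≐M , fewM , eqM) none

    -- If 𝒯 ↾ φ i were not bounded by q′ and d for every i up to the number of
    -- codes, then two of the φ i would hold in generic structures with the same
    -- code, so they would be consistent.
    bounded-↾ : ∀ {q d 𝒯} → Bounded q (suc d) 𝒯 → (φ : ℕ → Sentence L) →
                (∀ m n → m ≢ n → Inconsistent (φ m) (φ n)) →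
                ∃ λ q′ → ∃ λ i → Bounded q′ d (𝒯 ↾ φ i)
    bounded-↾ {q} {d} {𝒯} bounded φ inconsistent =
      q′ , dne λ none →
        let i , j , i<j , eq = Fin.pigeonhole ℕ.≤-refl λ i → code q (model none i) in
        inconsistent (toℕ i) (toℕ j) (ℕ.<⇒≢ i<j) (model none j)
          ( agree⇒⊨ (generic-agree q≤q′ (model-generic none i) (model-generic none j) eq)
                    (s≤s z≤n) (φ (toℕ i)) (φ≤q′ (Fin.toℕ<n i)) (model-⊨ none i)
          , model-⊨ none j)
      where
      bound = upperBound (qrank ∘ φ) (suc (codes q))

      q′ : ℕ
      q′ = suc (q + proj₁ bound)

      q≤q′ : q ≤ q′
      q≤q′ = ℕ.m≤n⇒m≤1+n (ℕ.m≤m+n q _)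

      φ≤q′ : ∀ {i} → i < suc (codes q) → qrank (φ i) ≤ q′
      φ≤q′ i< = ℕ.m≤n⇒m≤1+n (ℕ.m≤n⇒m≤o+n q (proj₂ bound i<))

      None : Set _
      None = ¬ ∃ λ i → Bounded q′ d (𝒯 ↾ φ i)

      genericModel : None → ∀ i → ∃ λ M → M ⊨ φ i × Generic d q q′ M
      genericModel none i = dne λ noModel → none (i , λ T (T∈𝒯 , φ∈T) →
        let M , T≐M , few = bounded T T∈𝒯
        in M , T≐M , ℕ.≰⇒> λ many →
             noModel (M , proj₁ T≐M φ∈T , generic (ℕ.≤-pred few) many))

      model : None → Fin (suc (codes q)) → RelStructure L
      model none i = proj₁ (genericModel none (toℕ i))

      model-⊨ : ∀ none i → model none i ⊨ φ (toℕ i)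
      model-⊨ none i = proj₁ (proj₂ (genericModel none (toℕ i)))

      model-generic : ∀ none i → Generic d q q′ (model none i)
      model-generic none i = proj₂ (proj₂ (genericModel none (toℕ i)))

    IsSucc-ω⇒≡ : ∀ {β d} → WellOrder.IsSucc ω (suc d) β → β ≡ d
    IsSucc-ω⇒≡ (β<1+d , next) =
      ℕ.≤-antisym (ℕ.≤-pred β<1+d) (ℕ.≮⇒≥ (next _ ℕ.≤-refl))

    -- Induction on `d`: `bounded-↾` finds one `φ i` whose subfamily is bounded by the predecessor,
    -- at a new threshold, so `q` must vary. For `d = 0` the family is empty, and `ω` has no limit
    -- positions.
    bounded⇒¬RS≥ : ∀ d {q 𝒯} → Bounded q d 𝒯 → ¬ RS≥ ω 𝒯 d
    bounded⇒¬RS≥ zero bounded (≥zero _ (T , T∈𝒯)) with () ← proj₂ (proj₂ (bounded T T∈𝒯))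
    bounded⇒¬RS≥ zero bounded (≥limit (nonzero , _) _) = nonzero λ _ ()
    bounded⇒¬RS≥ (suc d) bounded (≥zero isZero _) = isZero d ℕ.≤-refl
    -- This clause concerns position 1 only, where the family is finite.
    bounded⇒¬RS≥ (suc d) bounded (≥one s isZero infinite) with refl ← IsSucc-ω⇒≡ s | d
    ... | zero  = infinite (bounded⇒finite bounded)
    ... | suc d = isZero d ℕ.≤-refl
    bounded⇒¬RS≥ (suc d) bounded (≥succ s φ inconsistent rs) with refl ← IsSucc-ω⇒≡ s =
      let q′ , i , b = bounded-↾ bounded φ inconsistent in bounded⇒¬RS≥ d b (rs i)
    bounded⇒¬RS≥ (suc d) bounded (≥limit (_ , nonsucc) _) =
      nonsucc d (ℕ.≤-refl , λ γ γ<1+d d<γ → ℕ.<⇒≱ d<γ (ℕ.≤-pred γ<1+d))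

    modelled⇒RS-finite : {𝒯 : Family L} → (∃ λ T → 𝒯 T) →
                         (∀ T → 𝒯 T → ∃ λ M → T ≐ Th M) → ∃ λ n → RS 𝒯 ≡ n
    modelled⇒RS-finite {𝒯} nonempty modelled =
      lastTrue (RS≥ ω 𝒯) (≥zero (λ _ ()) nonempty) (suc cells)
        -- Any threshold would do, since no structure has more than `cells` large cells.
        (bounded⇒¬RS≥ (suc cells) {q = 0} λ T T∈𝒯 →
          let M , T≐M = modelled T T∈𝒯 in M , T≐M , s≤s (∣p∣≤n (large 0 M)))

  -- The dichotomy for signatures.

  module _ (Sg : Signature ℓ) where

    open Signature Sg

    finiteMonadic⇒RS-finite : FiniteMonadic Sg → ∃ λ n → RS AllTheories Sg ≡ n
    finiteMonadic⇒RS-finite ((_ , preds) , (_ , funs) , predArity≤1 , funArity≡0) =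
      Monadic.modelled⇒RS-finite (↔-trans (preds ⊎-↔ funs) (↔-sym Fin.+↔⊎)) monadic
        (_ , Infinite.Th∈AllTheories Sg trivial)
        (λ T (M , T≐M) → graphStructure Sg M , T≐M)
      where
      monadic : ∀ R → arity (graphLanguage Sg) R ≤ 1
      monadic (inj₁ P) = predArity≤1 P
      -- The graph of a constant is unary.
      monadic (inj₂ f) = s≤s (ℕ.≤-reflexive (funArity≡0 f))

      -- Its theory shows that the family is nonempty, so the rank is at least 0.
      trivial : Structure Sg
      trivial = record
        { Carrier = ⊤
        ; point   = tt
        ; pred    = λ _ _ → ⊤
        ; fun     = λ _ _ → tt
        }

    ¬finiteMonadic⇒RS∞ : ¬ FiniteMonadic Sg → RS AllTheories Sg ≡∞[ o ]
    ¬finiteMonadic⇒RS∞ ¬fm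
      with em {P = ∃ λ k → PredSym ↔ Fin k} | em {P = ∃ λ m → FunSym ↔ Fin m}
         | em {P = ∃ λ R → 2 ≤ arity (graphLanguage Sg) R}
    ... | no infinite | _ | _             = Infinite.infinitelyManyPredicates Sg infinite
    ... | _ | no infinite | _             = Infinite.infinitelyManyFunctions Sg infinite
    ... | _ | _ | yes (R , 2≤)            = Infinite.nonMonadic Sg R 2≤
    ... | yes preds | yes funs | no ¬2≤   = contradiction
      ( preds , funs
      , (λ P → ℕ.≤-pred (ℕ.≰⇒> λ 2≤ → ¬2≤ (inj₁ P , 2≤)))
      , (λ f → ℕ.n≤0⇒n≡0 (ℕ.≤-pred (ℕ.≤-pred (ℕ.≰⇒> λ 2≤ → ¬2≤ (inj₂ f , 2≤))))))
      ¬fm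

theorem2p8 : (∀ {a} → ExcludedMiddle a) →
    ∀ {ℓ : Level} (o : Level) (Σ : Signature ℓ) →
    (FiniteMonadic Σ → ∃ λ n → RS (AllTheories Σ) ≡ n)
    × (¬ FiniteMonadic Σ → RS (AllTheories Σ) ≡∞[ o ])
theorem2p8 em o Σ = Classical.finiteMonadic⇒RS-finite em Σ , Classical.¬finiteMonadic⇒RS∞ em Σ
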